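{- Let $\Gamma$ be an infinite highly-arc-transitive connected digraph such that the in-valency and the out-valency are both equal to some prime $p$. Then either $\Gamma$ is two-ended or the subdigraph spanned by the descendant set of a vertex $v$ is a rooted tree with out-valency $p$ (for every vertex $v$).
   Context: A digraph $\Gamma=(V\Gamma,E\Gamma)$ has vertex set $V\Gamma$ and arc set $E\Gamma\subseteq V\Gamma\times V\Gamma$. It is connected if its underlying undirected graph is connected. The in-valency (out-valency) of a vertex $v$ is the number of vertices $u$ with $(u,v)\in E\Gamma$ (respectively $(v,u)\in E\Gamma$). A $k$-arc is a sequence of vertices $v_0,\dots,v_k$ with $(v_i,v_{i+1})\in E\Gamma$ for $0\le i<k$ (a 0-arc is a vertex). $\Gamma$ is highly-arc-transitive if $\mathrm{Aut}(\Gamma)$ is transitive on the $k$-arcs for all $k$. A ray is a one-way infinite path (in the underlying undirected graph) with distinct vertices. The ends of a digraph are the equivalence classes of rays, where two rays are equivalent if there is an infinite family of pairwise disjoint paths (ignoring directions) each having its initial vertex in one ray and terminal vertex in the other. A digraph is two-ended if it is connected and has exactly two ends. The descendant set of a vertex $v$ is the set of vertices $w$ such that for some $k\ge 0$ there is a $k$-arc with initial vertex $v$ and terminal vertex $w$ (so $v$ belongs to it). The subdigraph spanned by a set of vertices is the induced subdigraph. A rooted tree with out-valency $p$ here means a digraph whose underlying graph is a tree, with a root $v$, all arcs directed away from the root, and every vertex having out-valency $p$. -}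

module Defs where

open import Data.Fin using (Fin; zero; suc; inject₁; fromℕ)
open import Data.Nat using (ℕ; suc; _≤_)
open import Data.Product using (Σ-syntax; ∃-syntax; _×_)
open import Data.Refinement using (Refinement-syntax; value)
open import Data.Sum using (_⊎_)
open import Function.Bundles using (_↔_; _⇔_; Inverse)
open import Function.Definitions using (Injective)
open import Level using (Level; _⊔_) renaming (suc to lsuc)
open import Relation.Binary.Construct.Closure.Equivalence using (EqClosure)
open import Relation.Binary.Construct.Closure.Symmetric using (SymClosure)
open import Relation.Binary.PropositionalEquality using (_≡_; _≢_)
open import Relation.Nullary using (¬_)

private
  variable
    a ℓ p : Level

-- `Arc` need not be proof-irrelevant: only whether `Arc u v` is inhabited
-- matters below, so it stands for a subset of `Vertex × Vertex`.
record Digraph (a ℓ : Level) : Set (lsuc (a ⊔ ℓ)) where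
  field
    Vertex : Set a
    Arc    : Vertex → Vertex → Set ℓ

open Digraph public

underlying : Digraph a ℓ → Digraph a ℓ
underlying Γ = record { Vertex = Vertex Γ ; Arc = SymClosure (Arc Γ) }

-- The vertices are a refinement type rather than a Σ-type, so that a vertex
-- satisfying P for several reasons occurs only once.
induced : (Γ : Digraph a ℓ) → (Vertex Γ → Set p) → Digraph (a ⊔ p) ℓ
induced Γ P = record
  { Vertex = [ v ∈ Vertex Γ ∣ P v ]
  ; Arc    = λ u v → Arc Γ (value u) (value v)
  }

Infinite : Digraph a ℓ → Set a
Infinite Γ = ¬ (∃[ n ] (Vertex Γ ↔ Fin n))

Connected : Digraph a ℓ → Set (a ⊔ ℓ)
Connected Γ = ∀ u v → EqClosure (Arc Γ) u v

-- Exactly n elements of A satisfy P (elements, not proofs, are counted).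
HasSize : {A : Set a} → (A → Set p) → ℕ → Set (a ⊔ p)
HasSize {A = A} P n =
  Σ[ f ∈ (Fin n → A) ] Injective _≡_ _≡_ f × (∀ x → P x ⇔ (∃[ i ] f i ≡ x))

InValency OutValency : (Γ : Digraph a ℓ) → Vertex Γ → ℕ → Set (a ⊔ ℓ)
InValency  Γ v n = HasSize (λ u → Arc Γ u v) n
OutValency Γ v n = HasSize (λ u → Arc Γ v u) n

record KArc (Γ : Digraph a ℓ) (k : ℕ) : Set (a ⊔ ℓ) where
  field
    vertex : Fin (suc k) → Vertex Γ
    step   : ∀ (i : Fin k) → Arc Γ (vertex (inject₁ i)) (vertex (suc i))

  initial terminal : Vertex Γ
  initial  = vertex zero
  terminal = vertex (fromℕ k)

open KArc public

KArcFromTo : (Γ : Digraph a ℓ) → ℕ → Vertex Γ → Vertex Γ → Set (a ⊔ ℓ)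
KArcFromTo Γ k u v = Σ[ s ∈ KArc Γ k ] initial s ≡ u × terminal s ≡ v

record Automorphism (Γ : Digraph a ℓ) : Set (a ⊔ ℓ) where
  field
    bijection : Vertex Γ ↔ Vertex Γ

  apply : Vertex Γ → Vertex Γ
  apply = Inverse.to bijection

  field
    arc⇔ : ∀ u v → Arc Γ u v ⇔ Arc Γ (apply u) (apply v)

open Automorphism public

HighlyArcTransitive : Digraph a ℓ → Set (a ⊔ ℓ)
HighlyArcTransitive Γ =
  ∀ k (s t : KArc Γ k) →
  Σ[ g ∈ Automorphism Γ ] (∀ i → apply g (vertex s i) ≡ vertex t i)

record Ray (Γ : Digraph a ℓ) : Set (a ⊔ ℓ) where
  field
    at       : ℕ → Vertex Γ
    distinct : Injective _≡_ _≡_ at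
    step     : ∀ i → Arc (underlying Γ) (at i) (at (suc i))

-- Directions are ignored; a path may consist of a single vertex.
record Path (Γ : Digraph a ℓ) : Set (a ⊔ ℓ) where
  field
    length   : ℕ
    walk     : KArc (underlying Γ) length
    distinct : Injective _≡_ _≡_ (vertex walk)

record _∼_ {Γ : Digraph a ℓ} (r s : Ray Γ) : Set (a ⊔ ℓ) where
  field
    path     : ℕ → Path Γ
    starts   : ∀ n → ∃[ i ] initial (Path.walk (path n)) ≡ Ray.at r i
    ends     : ∀ n → ∃[ i ] terminal (Path.walk (path n)) ≡ Ray.at s i
    disjoint : ∀ m n → m ≢ n → ∀ i j →
               vertex (Path.walk (path m)) i ≢ vertex (Path.walk (path n)) j

-- The relation _∼_ has exactly two equivalence classes.
ExactlyTwoEnds : Digraph a ℓ → Set (a ⊔ ℓ)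
ExactlyTwoEnds Γ =
  Σ[ r ∈ Ray Γ ] Σ[ s ∈ Ray Γ ] ¬ (r ∼ s) × (∀ t → t ∼ r ⊎ t ∼ s)

TwoEnded : Digraph a ℓ → Set (a ⊔ ℓ)
TwoEnded Γ = Connected Γ × ExactlyTwoEnds Γ

Descendant : (Γ : Digraph a ℓ) → Vertex Γ → Vertex Γ → Set (a ⊔ ℓ)
Descendant Γ v w = ∃[ k ] KArcFromTo Γ k v w

descendants : (Γ : Digraph a ℓ) → Vertex Γ → Digraph (a ⊔ ℓ) ℓ
descendants Γ v = induced Γ (Descendant Γ v)

-- A cycle of the underlying graph on the n + 1 distinct vertices of `walk`.
-- n = 0 is a loop; n = 1 is excluded, since it only traverses one edge back
-- and forth.
record Cycle (Γ : Digraph a ℓ) : Set (a ⊔ ℓ) where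
  field
    n        : ℕ
    n≢1      : n ≢ 1
    walk     : KArc (underlying Γ) n
    distinct : Injective _≡_ _≡_ (vertex walk)
    closing  : Arc (underlying Γ) (terminal walk) (initial walk)

UnderlyingTree : Digraph a ℓ → Set (a ⊔ ℓ)
UnderlyingTree Γ = Connected Γ × ¬ Cycle Γ

-- n is the distance from u to v in the underlying graph.
Distance : (Γ : Digraph a ℓ) → Vertex Γ → Vertex Γ → ℕ → Set (a ⊔ ℓ)
Distance Γ u v n =
  KArcFromTo (underlying Γ) n u v ×
  (∀ m → KArcFromTo (underlying Γ) m u v → n ≤ m)

-- In particular, this rules out a pair of opposite arcs, which the underlying
-- graph does not distinguish from a single arc.
DirectedAwayFrom : (Γ : Digraph a ℓ) → Vertex Γ → Set (a ⊔ ℓ)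
DirectedAwayFrom Γ r =
  ∀ u v n → Arc Γ u v → Distance Γ r u n → Distance Γ r v (suc n)

RootedTree : ℕ → Digraph a ℓ → Set (a ⊔ ℓ)
RootedTree d Γ =
  UnderlyingTree Γ ×
  (∃[ r ] DirectedAwayFrom Γ r) ×
  (∀ v → OutValency Γ v d)

{-# OPTIONS --safe #-}

-- Write D_k(v) for the set of vertices reached from v by a k-arc.  If w ∈ D_{k+1}(v),
-- the number c of in-neighbours of w lying in D_k(v) depends only on k, and counting the
-- arcs between the two levels gives |D_{k+1}(v)| · c = |D_k(v)| · p.  Hence |D_k(v)|
-- divides p^k and c divides p^{k+1}, so c is 1 or p.
--
-- If c = 1 for every k, descendants have unique parents and desc(v) is a tree.  If c = p
-- for some K, then c = p for every k ≥ K and |D_k(v)| no longer depends on k ≥ K.  Along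
-- a backward ray w_0 ← w_1 ← … the sets D_k(w_i) with k ≥ K then depend only on k − i,
-- and they are the finite layers of a height function onto ℤ that makes Γ a two-ended
-- strip.
module Submission where

open import Axiom.ExcludedMiddle using (ExcludedMiddle)
open import Data.Empty using (⊥; ⊥-elim)
open import Data.Fin.Base using (Fin; zero; suc; inject₁; fromℕ; toℕ)
import Data.Fin.Properties as Fin
open import Data.Fin.Relation.Unary.Top using (view; ‵fromℕ; ‵inject₁)
open import Data.Integer.Base as ℤ using (ℤ; +_; -[1+_]; 0ℤ; 1ℤ; _⊖_)
import Data.Integer.Properties as ℤ
open import Data.Irrelevant using ([_])
open import Data.List.Base
  using (List; []; _∷_; _++_; length; lookup; filter; map; tabulate; deduplicate; concatMap; allFin; upTo)
open import Data.List.Membership.Propositional using (_∈_; lose; find)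
open import Data.List.Membership.Propositional.Properties
  using (∈-lookup; ∈-tabulate⁺; ∈-tabulate⁻; ∈-filter⁺; ∈-filter⁻; ∈-deduplicate⁺; ∈-deduplicate⁻;
         ∈-concatMap⁺; ∈-concatMap⁻; ∈-++⁺ˡ; ∈-++⁺ʳ; ∈-upTo⁺; ∈-allFin; ∈-length)
open import Data.List.Membership.Setoid.Properties using (index-injective)
open import Data.List.Properties using (length-tabulate)
open import Data.List.Relation.Unary.All as All using ([]; _∷_)
open import Data.List.Relation.Unary.All.Properties using (¬Any⇒All¬)
open import Data.List.Relation.Unary.AllPairs using ([]; _∷_)
open import Data.List.Relation.Unary.Any using (here; there)
open import Data.List.Relation.Unary.Unique.Propositional using (Unique)
open import Data.List.Relation.Unary.Unique.Propositional.Properties using (tabulate⁺; filter⁺)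
import Data.List.Relation.Unary.Unique.DecPropositional.Properties as UniqueDec
open import Data.Nat.Base hiding (_⊔_)
open import Data.Nat.Coprimality using (coprime-divisor; prime⇒coprime) renaming (sym to coprime-sym)
open import Data.Nat.Divisibility
open import Data.Nat.ListAction using (sum)
open import Data.Nat.Primality using (Prime; prime⇒nonZero; prime⇒nonTrivial)
open import Data.Nat.Properties
open import Algebra.Properties.CommutativeSemigroup +-commutativeSemigroup using (x∙yz≈y∙xz)
open import Data.Product using (Σ-syntax; ∃-syntax; _×_; _,_; proj₁; proj₂)
open import Data.Refinement using (_,_; value; value-injective)
open import Data.Sum using (_⊎_; inj₁; inj₂)
open import Function.Base using (_∘_; id)
open import Function.Bundles using (Equivalence; Inverse; mk⇔)
open import Function.Definitions using (Injective)
open import Level using (Level; _⊔_)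
open import Relation.Binary using (Rel; REL; Decidable; tri<; tri≈; tri>)
open import Relation.Binary.Construct.Closure.Equivalence as Eq using (EqClosure)
open import Relation.Binary.Construct.Closure.ReflexiveTransitive using (ε; _◅_)
open import Relation.Binary.Construct.Closure.Symmetric as Sym using (SymClosure; fwd; bwd)
open import Relation.Binary.PropositionalEquality
open import Relation.Nullary hiding (Irrelevant)
open import Defs

private
  variable
    a b q r ℓ : Level
    A : Set a
    B : Set b
    R : Rel A r
    x y z : A
    k l n i j : ℕ

-- Finite sets as repetition-free lists, and double counting

record _enumerates_ {A : Set a} (xs : List A) (P : A → Set q) : Set (a ⊔ q) where
  field
    unique   : Unique xs
    sound    : ∀ {x} → x ∈ xs → P x
    complete : ∀ {x} → P x → x ∈ xs

open _enumerates_

hasSize⇒list : {P : A → Set q} {n : ℕ} → HasSize P n → ∃[ xs ] length xs ≡ n × xs enumerates P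
hasSize⇒list {P = P} (f , f-injective , P⇔f) = tabulate f , length-tabulate f , record
  { unique   = tabulate⁺ f-injective
  ; sound    = λ x∈ → let i , x≡ = ∈-tabulate⁻ x∈ in Equivalence.from (P⇔f _) (i , sym x≡)
  ; complete = λ Px → let i , fi≡x = Equivalence.to (P⇔f _) Px in
                      subst (_∈ tabulate f) fi≡x (∈-tabulate⁺ i)
  }

lookup-injective : {xs : List A} → Unique xs → ∀ {i j} → lookup xs i ≡ lookup xs j → i ≡ j
lookup-injective (x∉ ∷ _) {zero}  {zero}  _  = refl
lookup-injective (x∉ ∷ _) {zero}  {suc j} eq = ⊥-elim (All.lookup x∉ (∈-lookup j) eq)
lookup-injective (x∉ ∷ _) {suc i} {zero}  eq = ⊥-elim (All.lookup x∉ (∈-lookup i) (sym eq))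
lookup-injective (_ ∷ u)  {suc i} {suc j} eq = cong suc (lookup-injective u eq)

-- Pigeonhole principle: sending `i` to the position of `f i` in `ys` is an injection between finite
-- ordinals.
injective⇒≤length : {n : ℕ} (f : Fin n → A) → (∀ {i j} → f i ≡ f j → i ≡ j) →
                    {ys : List A} → (∀ i → f i ∈ ys) → n ≤ length ys
injective⇒≤length f f-injective f∈ =
  Fin.injective⇒≤ λ eq → f-injective (index-injective (setoid _) (f∈ _) (f∈ _) eq)

length≤ : {P : A → Set q} {Q : B → Set r} {xs : List A} {ys : List B} →
          xs enumerates P → ys enumerates Q → (f : A → B) → (∀ {x y} → f x ≡ f y → x ≡ y) →
          (∀ {x} → P x → Q (f x)) → length xs ≤ length ys
length≤ {xs = xs} exs eys f f-injective P⇒Q =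
  injective⇒≤length (f ∘ lookup xs) (lookup-injective (unique exs) ∘ f-injective)
                    (complete eys ∘ P⇒Q ∘ sound exs ∘ ∈-lookup)

⊆⇒length≤ : {xs ys : List A} → Unique xs → (∀ {x} → x ∈ xs → x ∈ ys) → length xs ≤ length ys
⊆⇒length≤ {xs = xs} u xs⊆ys = injective⇒≤length (lookup xs) (lookup-injective u) (xs⊆ys ∘ ∈-lookup)

length-≡ : {P : A → Set q} {Q : A → Set r} {xs ys : List A} → xs enumerates P → ys enumerates Q →
           (∀ {x} → P x → Q x) → (∀ {x} → Q x → P x) → length xs ≡ length ys
length-≡ exs eys P⇒Q Q⇒P = ≤-antisym (length≤ exs eys id id P⇒Q) (length≤ eys exs id id Q⇒P)

filter-enumerates : {P : A → Set q} {Q : A → Set r} (Q? : ∀ x → Dec (Q x)) {xs : List A} →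
                    xs enumerates P → filter Q? xs enumerates (λ x → P x × Q x)
filter-enumerates Q? {xs} exs = record
  { unique   = filter⁺ Q? (unique exs)
  ; sound    = λ x∈ → let x∈xs , Qx = ∈-filter⁻ Q? {xs = xs} x∈ in sound exs x∈xs , Qx
  ; complete = λ (Px , Qx) → ∈-filter⁺ Q? (complete exs Px) Qx
  }

sum-const : (f : A → ℕ) (c : ℕ) (xs : List A) → (∀ {x} → x ∈ xs → f x ≡ c) →
            sum (map f xs) ≡ length xs * c
sum-const f c []       f≡c = refl
sum-const f c (x ∷ xs) f≡c = cong₂ _+_ (f≡c (here refl)) (sum-const f c xs (f≡c ∘ there))

module _ {R : REL A B r} (R? : Decidable R) where

  private
    successors : List B → A → ℕ
    successors ys x = length (filter (R? x) ys)

    predecessors : List A → B → ℕ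
    predecessors xs y = length (filter (λ x → R? x y) xs)

    sum-predecessors-∷ : ∀ x xs ys → successors ys x + sum (map (predecessors xs) ys) ≡
                                     sum (map (predecessors (x ∷ xs)) ys)
    sum-predecessors-∷ x xs []       = refl
    sum-predecessors-∷ x xs (y ∷ ys) with R? x y
    ... | yes _ = cong suc (trans (x∙yz≈y∙xz (successors ys x) (predecessors xs y) _)
                                  (cong (λ m → predecessors xs y + m) (sum-predecessors-∷ x xs ys)))
    ... | no  _ = trans (x∙yz≈y∙xz (successors ys x) (predecessors xs y) _)
                        (cong (λ m → predecessors xs y + m) (sum-predecessors-∷ x xs ys))

  -- The ones of a 0/1 matrix are summed by rows and by columns. The induction adds one row at a
  -- time, and `sum-predecessors-∷` distributes the new row over the columns.
  double-count : ∀ xs ys → sum (map (λ x → length (filter (R? x) ys)) xs) ≡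
                           sum (map (λ y → length (filter (λ x → R? x y) xs)) ys)
  double-count []       ys = sym (trans (sum-const (λ _ → 0) 0 ys (λ _ → refl)) (*-zeroʳ (length ys)))
  double-count (x ∷ xs) ys = trans (cong (λ m → successors ys x + m) (double-count xs ys))
                                   (sum-predecessors-∷ x xs ys)

-- A nonzero `c` below `p` is coprime to `p`, so the factors `p` can be cancelled one by one until
-- `c ∣ 1` remains.
prime-power-divisor : ∀ {p} → Prime p → ∀ {c} .{{_ : NonZero c}} n → c ≤ p → c ∣ p ^ n → c ≡ 1 ⊎ c ≡ p
prime-power-divisor {p} p-prime {c} n c≤p c∣pⁿ with m≤n⇒m<n∨m≡n c≤p
... | inj₂ c≡p = inj₂ c≡p
... | inj₁ c<p = inj₁ (∣1⇒≡1 (cancel n c∣pⁿ))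
  where
  cancel : ∀ n → c ∣ p ^ n → c ∣ 1
  cancel zero    d = d
  cancel (suc n) d = cancel n (coprime-divisor (coprime-sym (prime⇒coprime p-prime c<p)) d)

module Classical (em : ∀ {ℓ} → ExcludedMiddle ℓ) where

  -- If some `y` in `ys` were missing from `xs`, then `y ∷ xs` would be a repetition-free list
  -- inside `ys` that is longer than `ys`.
  ⊆∧length≥⇒⊇ : {xs ys : List A} → Unique xs → (∀ {x} → x ∈ xs → x ∈ ys) →
                length ys ≤ length xs → ∀ {y} → y ∈ ys → y ∈ xs
  ⊆∧length≥⇒⊇ {xs = xs} {ys} u xs⊆ys ys≤xs {y} y∈ys = decidable-stable em λ y∉xs →
    <⇒≱ (⊆⇒length≤ (¬Any⇒All¬ xs y∉xs ∷ u)
                   λ { (here refl) → y∈ys ; (there x∈) → xs⊆ys x∈ }) ys≤xs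

  -- The order may be partial. The minimal element of the tail is kept unless the head lies strictly
  -- below it; in that case transitivity makes the head minimal. The membership of `x₀` rules out
  -- the empty list.
  minimal : {_<_ : Rel A r} → (∀ {x} → ¬ x < x) → (∀ {x y z} → x < y → y < z → x < z) →
            ∀ {x₀} {xs : List A} → x₀ ∈ xs → ∃[ m ] m ∈ xs × (∀ {x} → x ∈ xs → ¬ x < m)
  minimal {_<_ = _<_} irrefl trans′ {xs = x₀ ∷ []} _ =
    x₀ , here refl , λ { (here refl) → irrefl }
  minimal {_<_ = _<_} irrefl trans′ {xs = x₀ ∷ xs@(_ ∷ _)} _
    with m , m∈ , m-min ← minimal {_<_ = _<_} irrefl trans′ {xs = xs} (here refl)
    with em {P = x₀ < m}
  ... | yes x₀<m = x₀ , here refl , λ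
    { (here refl) → irrefl
    ; (there x∈)  → λ x<x₀ → m-min x∈ (trans′ x<x₀ x₀<m) }
  ... | no  x₀≮m = m , there m∈ , λ { (here refl) → x₀≮m ; (there x∈) → m-min x∈ }

-- Walks of prescribed length

infixr 5 _∷_ _⊕_

data Steps {A : Set a} (R : Rel A r) : ℕ → A → A → Set (a ⊔ r) where
  []  : ∀ {x} → Steps R 0 x x
  _∷_ : ∀ {n x y z} → R x y → Steps R n y z → Steps R (suc n) x z

_⊕_ : Steps R k x y → Steps R l y z → Steps R (k + l) x z
[]      ⊕ t = t
(e ∷ s) ⊕ t = e ∷ (s ⊕ t)

splitAt : ∀ k → Steps R (k + l) x z → ∃[ y ] Steps R k x y × Steps R l y z
splitAt zero    s       = _ , [] , s
splitAt (suc k) (e ∷ s) = let y , s₁ , s₂ = splitAt k s in y , e ∷ s₁ , s₂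

snoc : Steps R k x y → R y z → Steps R (suc k) x z
snoc []      e = e ∷ []
snoc (d ∷ s) e = d ∷ snoc s e

unsnoc : Steps R (suc k) x z → ∃[ y ] Steps R k x y × R y z
unsnoc (e ∷ [])        = _ , [] , e
unsnoc (e ∷ s@(_ ∷ _)) = let y , s′ , e′ = unsnoc s in y , e ∷ s′ , e′

fromSequence : ∀ n (f : Fin (suc n) → A) → (∀ (i : Fin n) → R (f (inject₁ i)) (f (suc i))) →
               Steps R n (f zero) (f (fromℕ n))
fromSequence zero    f f-step = []
fromSequence (suc n) f f-step = f-step zero ∷ fromSequence n (f ∘ suc) (f-step ∘ suc)

vertexOf : Steps R n x y → Fin (suc n) → _
vertexOf {x = x} s       zero    = x
vertexOf         (_ ∷ s) (suc i) = vertexOf s i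

vertexOf-step : (s : Steps R n x y) (i : Fin n) → R (vertexOf s (inject₁ i)) (vertexOf s (suc i))
vertexOf-step (e ∷ s) zero    = e
vertexOf-step (e ∷ s) (suc i) = vertexOf-step s i

vertexOf-last : (s : Steps R n x y) → vertexOf s (fromℕ n) ≡ y
vertexOf-last []      = refl
vertexOf-last (_ ∷ s) = vertexOf-last s

module _ {Γ : Digraph a ℓ} where

  fromKArc : (s : KArc Γ k) → Steps (Arc Γ) k (initial s) (terminal s)
  fromKArc s = fromSequence _ (vertex s) (step s)

  toKArc : ∀ {v w} → Steps (Arc Γ) k v w → KArc Γ k
  toKArc s = record { vertex = vertexOf s ; step = vertexOf-step s }

  fromKArcFromTo : ∀ {v w} → KArcFromTo Γ k v w → Steps (Arc Γ) k v w
  fromKArcFromTo (s , refl , refl) = fromKArc s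

  toKArcFromTo : ∀ {v w} → Steps (Arc Γ) k v w → KArcFromTo Γ k v w
  toKArcFromTo s = toKArc s , refl , vertexOf-last s

  apply-injective : (g : Automorphism Γ) {v w : Vertex Γ} → apply g v ≡ apply g w → v ≡ w
  apply-injective g eq = trans (sym (strictlyInverseʳ _)) (trans (cong from eq) (strictlyInverseʳ _))
    where open Inverse (bijection g)

  apply-arc : (g : Automorphism Γ) {v w : Vertex Γ} → Arc Γ v w → Arc Γ (apply g v) (apply g w)
  apply-arc g = Equivalence.to (arc⇔ g _ _)

  apply-steps : (g : Automorphism Γ) {v w : Vertex Γ} →
                Steps (Arc Γ) k v w → Steps (Arc Γ) k (apply g v) (apply g w)
  apply-steps g []      = []
  apply-steps g (e ∷ s) = apply-arc g e ∷ apply-steps g s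

steps⇒closure : Steps R n x y → EqClosure R x y
steps⇒closure []      = ε
steps⇒closure (e ∷ s) = fwd e ◅ steps⇒closure s

-- These are the cyclic predecessor and successor of position `m`, which differ because the cycle
-- has at least three vertices. The first and the last position use the closing edge.
two-neighbours : {Γ : Digraph a ℓ} (w : KArc (underlying Γ) (2+ n)) →
                 Arc (underlying Γ) (terminal w) (initial w) → ∀ m →
                 ∃[ i ] ∃[ j ] i ≢ j × Arc (underlying Γ) (vertex w i) (vertex w m)
                                     × Arc (underlying Γ) (vertex w j) (vertex w m)
two-neighbours {n = n} w closing zero =
  suc zero , fromℕ (2+ n) , (λ ()) , Sym.symmetric _ (step w zero) , closing
two-neighbours w closing (suc m) with view m
... | ‵fromℕ     = inject₁ m , zero , (λ ()) , step w m , Sym.symmetric _ closing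
... | ‵inject₁ j = inject₁ m , suc (suc j) , inject₁≢suc² , step w m , Sym.symmetric _ (step w (suc j))
  where
  inject₁≢suc² : inject₁ (inject₁ j) ≢ suc (suc j)
  inject₁≢suc² eq = <⇒≢ (m<n⇒m<1+n (n<1+n (toℕ j)))
    (trans (sym (trans (Fin.toℕ-inject₁ (inject₁ j)) (Fin.toℕ-inject₁ j))) (cong toℕ eq))

-- Ends of a digraph with a height function

-- The injective reindexing `f` is what transfers distinctness of vertices, and any property of
-- them, from `s` to its suffix.
suffix : (s : Steps R n x y) (i : Fin (suc n)) →
         ∃[ m ] Σ[ t ∈ Steps R m (vertexOf s i) y ]
         Σ[ f ∈ (Fin (suc m) → Fin (suc n)) ] Injective _≡_ _≡_ f × (∀ j → vertexOf t j ≡ vertexOf s (f j))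
suffix s       zero    = _ , s , id , id , λ _ → refl
suffix (_ ∷ s) (suc i) =
  let m , t , f , f-injective , t≡s∘f = suffix s i
  in  m , t , suc ∘ f , f-injective ∘ Fin.suc-injective , t≡s∘f

-- The values may drop arbitrarily but rise by at most one per step, so they cannot pass `z` from
-- below without taking it.
intermediate-value : ∀ n (f : Fin (suc n) → ℤ) → (∀ i → f (suc i) ℤ.≤ ℤ.suc (f (inject₁ i))) →
                     ∀ {z} → f zero ℤ.≤ z → z ℤ.≤ f (fromℕ n) → ∃[ i ] f i ≡ z
intermediate-value zero    f f-step f₀≤z z≤fₙ = zero , ℤ.≤-antisym f₀≤z z≤fₙ
intermediate-value (suc n) f f-step {z} f₀≤z z≤fₙ with f zero ℤ.≟ z
... | yes f₀≡z = zero , f₀≡z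
... | no  f₀≢z =
  let i , fᵢ≡z = intermediate-value n (f ∘ suc) (f-step ∘ suc)
                   (ℤ.≤-trans (f-step zero) (ℤ.i<j⇒suc[i]≤j (ℤ.≤∧≢⇒< f₀≤z f₀≢z))) z≤fₙ
  in  suc i , fᵢ≡z

Restrict : {A : Set a} → Rel A r → (A → Set q) → Rel A (r ⊔ q)
Restrict R Q x y = R x y × Q x × Q y

module Ends (em : ∀ {ℓ} → ExcludedMiddle ℓ) {a ℓ : Level} (Γ : Digraph a ℓ) where

  private
    V = Vertex Γ
    Edge = SymClosure (Arc Γ)

  SimpleWalk : (V → Set q) → V → V → Set _
  SimpleWalk Q x y = ∃[ n ] Σ[ s ∈ Steps Edge n x y ] Injective _≡_ _≡_ (vertexOf s) × (∀ i → Q (vertexOf s i))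

  -- The vertex `x` is put in front of a simple walk from its neighbour. If `x` already occurs on
  -- that walk, the suffix starting there is taken instead.
  loop-erase : {Q : V → Set q} {x y : V} → Q x → EqClosure (Restrict (Arc Γ) Q) x y → SimpleWalk Q x y
  loop-erase Qx ε = 0 , [] , (λ { {zero} {zero} _ → refl }) , λ { zero → Qx }
  loop-erase {Q = Q} {x} {z} Qx (_◅_ {j = y} e s) = cons (loop-erase Qy s)
    where
    edge : SymClosure (Restrict (Arc Γ) Q) x y → Edge x y × Q y
    edge (fwd (e , _ , Qy)) = fwd e , Qy
    edge (bwd (e , Qy , _)) = bwd e , Qy
    Qy = proj₂ (edge e)
    cons : SimpleWalk Q y z → SimpleWalk Q x z
    cons (n , s , s-injective , s⊆Q) with em {P = ∃[ i ] vertexOf s i ≡ x}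
    ... | yes (i , refl) with m , t , f , f-injective , t≡s∘f ← suffix s i =
      m , t
      , (λ {j} {k} eq → f-injective (s-injective (trans (sym (t≡s∘f j)) (trans eq (t≡s∘f k)))))
      , λ j → subst Q (sym (t≡s∘f j)) (s⊆Q (f j))
    ... | no  x∉s = suc n , proj₁ (edge e) ∷ s , injective , λ { zero → Qx ; (suc i) → s⊆Q i }
      where
      injective : Injective _≡_ _≡_ (vertexOf (proj₁ (edge e) ∷ s))
      injective {zero}  {zero}  _  = refl
      injective {zero}  {suc j} eq = ⊥-elim (x∉s (j , sym eq))
      injective {suc i} {zero}  eq = ⊥-elim (x∉s (i , eq))
      injective {suc i} {suc j} eq = cong suc (s-injective eq)

  -- The slab of vertices whose height differs from `z` by at most `K`, with the absolute value
  -- split into two inequalities.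
  Near : (V → ℤ) → ℕ → ℤ → V → Set
  Near h K z x = h x ℤ.≤ z ℤ.+ + K × z ℤ.≤ h x ℤ.+ + K

  -- Applied both to a height function and to its negative, hence no assumption that
  -- arcs go up.
  module Upwards
    (h : V → ℤ) (h-step : ∀ {x y} → Edge x y → h y ℤ.≤ ℤ.suc (h x))
    (K : ℕ) (connected : ∀ {x y} → h x ≡ h y → EqClosure (Restrict (Arc Γ) (Near h K (h x))) x y)
    where

    Unbounded : Ray Γ → Set
    Unbounded t = ∀ N → ∃[ i ] + N ℤ.≤ h (Ray.at t i)

    walk-crosses : (w : KArc (underlying Γ) n) → ∀ {z} → h (initial w) ℤ.≤ z → z ℤ.≤ h (terminal w) →
                   ∃[ i ] h (vertex w i) ≡ z
    walk-crosses w = intermediate-value _ (h ∘ vertex w) (λ i → h-step (step w i))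

    ray-crosses : ∀ t → Unbounded t → ∀ {N} → h (Ray.at t 0) ℤ.≤ + N → ∃[ i ] h (Ray.at t i) ≡ + N
    ray-crosses t unbounded {N} h₀≤N with n , N≤hₙ ← unbounded N =
      let i , hᵢ≡N = walk-crosses segment h₀≤N
                       (ℤ.≤-trans N≤hₙ (ℤ.≤-reflexive (cong (h ∘ Ray.at t) (sym (Fin.toℕ-fromℕ n)))))
      in  toℕ i , hᵢ≡N
      where
      segment : KArc (underlying Γ) n
      segment = record
        { vertex = Ray.at t ∘ toℕ
        ; step   = λ i → subst (λ j → Edge (Ray.at t j) (Ray.at t (suc (toℕ i))))
                           (sym (Fin.toℕ-inject₁ i)) (Ray.step t (toℕ i))
        }

    module _ (r : Ray Γ) (h-r : ∀ n → h (Ray.at r n) ≡ + n) (t : Ray Γ) (unbounded : Unbounded t) where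

      private
        gap base : ℕ
        -- Slabs of radius `K` around two heights are disjoint once the heights are more than `2K`
        -- apart.
        gap  = suc (K + K)
        -- Starting at this absolute value puts every chosen height at or above the start of `t`, so
        -- `t` has to cross it.
        base = ℤ.∣ h (Ray.at t 0) ∣

        height : ℕ → ℕ
        height j = base + j * gap

        h₀≤height : ∀ j → h (Ray.at t 0) ℤ.≤ + height j
        h₀≤height j = ℤ.≤-trans (i≤∣i∣ (h (Ray.at t 0))) (ℤ.+≤+ (m≤m+n _ (j * gap)))
          where
          i≤∣i∣ : ∀ i → i ℤ.≤ + ℤ.∣ i ∣
          i≤∣i∣ (+ n)    = ℤ.≤-refl
          i≤∣i∣ -[1+ n ] = ℤ.-≤+

        crossing : ∀ j → ∃[ i ] h (Ray.at t i) ≡ + height j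
        crossing j = ray-crosses t unbounded (h₀≤height j)

        simple : ∀ j → SimpleWalk (Near h K (+ height j)) (Ray.at t (proj₁ (crossing j))) (Ray.at r (height j))
        simple j = loop-erase {Q = Near h K (+ height j)} (≤+K h≡ , ≤+K (sym h≡))
          (subst (λ z → EqClosure (Restrict (Arc Γ) (Near h K z))
                   (Ray.at t (proj₁ (crossing j))) (Ray.at r (height j))) h≡
            (connected (trans h≡ (sym (h-r (height j))))))
          where
          h≡ = proj₂ (crossing j)
          ≤+K : ∀ {z w} → z ≡ w → z ℤ.≤ w ℤ.+ + K
          ≤+K {z} refl = ℤ.i≤i+j z (+ K)

        apart : ∀ {m n x} → m < n → Near h K (+ height m) x → ¬ Near h K (+ height n) x
        apart {m} {n} {x} m<n (hx≤ , _) (_ , ≤hx) = <⇒≱ too-far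
          (ℤ.drop‿+≤+ (ℤ.≤-trans ≤hx (ℤ.+-monoˡ-≤ (+ K) hx≤)))
          where
          open ≤-Reasoning
          too-far : height m + K + K < height n
          too-far = begin-strict
            height m + K + K       ≡⟨ +-assoc (height m) K K ⟩
            height m + (K + K)     <⟨ +-monoʳ-< (height m) (n<1+n (K + K)) ⟩
            height m + gap         ≡⟨ +-assoc base (m * gap) gap ⟩
            base + (m * gap + gap) ≡⟨ cong (λ l → base + l) (+-comm (m * gap) gap) ⟩
            height (suc m)         ≤⟨ +-monoʳ-≤ base (*-monoˡ-≤ gap m<n) ⟩
            height n               ∎

      -- Both rays meet each of the heights `height j`. The two vertices found there are joined by a
      -- simple path within the slab around that height, and different slabs are disjoint.
      unbounded⇒∼ : t ∼ r
      unbounded⇒∼ = record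
        { path     = λ j → let n , s , s-injective , _ = simple j in
                           record { length = n ; walk = toKArc s ; distinct = s-injective }
        ; starts   = λ j → proj₁ (crossing j) , refl
        ; ends     = λ j → let _ , s , _ = simple j in height j , vertexOf-last s
        ; disjoint = disjoint
        }
        where
        near : ∀ j i → Near h K (+ height j) (vertexOf (proj₁ (proj₂ (simple j))) i)
        near j = proj₂ (proj₂ (proj₂ (simple j)))
        disjoint : ∀ m n → m ≢ n → ∀ i j →
                   vertexOf (proj₁ (proj₂ (simple m))) i ≢ vertexOf (proj₁ (proj₂ (simple n))) j
        disjoint m n m≢n i j eq with <-cmp m n
        ... | tri< m<n _ _ = apart m<n (near m i) (subst (Near h K (+ height n)) (sym eq) (near n j))
        ... | tri≈ _ m≡n _ = m≢n m≡n
        ... | tri> _ _ n<m = apart n<m (near n j) (subst (Near h K (+ height m)) eq (near m i))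

  module Strip
    (h : V → ℤ) (h-arc : ∀ {x y} → Arc Γ x y → h y ≡ ℤ.suc (h x))
    (layer : ℤ → List V) (layer-complete : ∀ {x} → x ∈ layer (h x))
    (K : ℕ) (connected : ∀ {x y} → h x ≡ h y → EqClosure (Restrict (Arc Γ) (Near h K (h x))) x y)
    (down up : Ray Γ)
    (h-down : ∀ n → h (Ray.at down n) ≡ ℤ.- + n) (h-up : ∀ n → h (Ray.at up n) ≡ + n)
    where

    private
      h⁻ : V → ℤ
      h⁻ x = ℤ.- h x

      h-step : ∀ {x y} → Edge x y → h y ℤ.≤ ℤ.suc (h x)
      h-step (fwd e) = ℤ.≤-reflexive (h-arc e)
      h-step {x} {y} (bwd e) = ℤ.≤-trans (ℤ.i≤suc[i] (h y))
        (ℤ.≤-trans (ℤ.≤-reflexive (sym (h-arc e))) (ℤ.i≤suc[i] (h x)))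

      -- Negation exchanges the two inequalities of `Near`; this lemma does it for one of them.
      neg-≤ : ∀ {i j} k → i ℤ.≤ j ℤ.+ k → ℤ.- j ℤ.≤ ℤ.- i ℤ.+ k
      neg-≤ {i} {j} k i≤j+k = begin
        ℤ.- j                       ≡⟨ ℤ.+-identityʳ (ℤ.- j) ⟨
        ℤ.- j ℤ.+ 0ℤ                ≡⟨ cong (λ m → ℤ.- j ℤ.+ m) (ℤ.+-inverseˡ k) ⟨
        ℤ.- j ℤ.+ (ℤ.- k ℤ.+ k)     ≡⟨ ℤ.+-assoc (ℤ.- j) (ℤ.- k) k ⟨
        ℤ.- j ℤ.+ ℤ.- k ℤ.+ k       ≡⟨ cong (ℤ._+ k) (ℤ.neg-distrib-+ j k) ⟨
        ℤ.- (j ℤ.+ k) ℤ.+ k         ≤⟨ ℤ.+-monoˡ-≤ k (ℤ.neg-mono-≤ i≤j+k) ⟩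
        ℤ.- i ℤ.+ k                 ∎
        where open ℤ.≤-Reasoning

      h⁻-step : ∀ {x y} → Edge x y → h⁻ y ℤ.≤ ℤ.suc (h⁻ x)
      h⁻-step {x} {y} e = subst (h⁻ y ℤ.≤_) (ℤ.+-comm (h⁻ x) 1ℤ)
        (neg-≤ 1ℤ (subst (h x ℤ.≤_) (ℤ.+-comm 1ℤ (h y)) (h-step (Sym.symmetric _ e))))

      near⁻ : ∀ {z x} → Near h K z x → Near h⁻ K (ℤ.- z) x
      near⁻ (hx≤ , ≤hx) = neg-≤ (+ K) ≤hx , neg-≤ (+ K) hx≤

      connected⁻ : ∀ {x y} → h⁻ x ≡ h⁻ y → EqClosure (Restrict (Arc Γ) (Near h⁻ K (h⁻ x))) x y
      connected⁻ eq = Eq.map (λ (e , Qx , Qy) → e , near⁻ Qx , near⁻ Qy) (connected (ℤ.neg-injective eq))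

      h⁻-down : ∀ n → h⁻ (Ray.at down n) ≡ + n
      h⁻-down n = trans (cong ℤ.-_ (h-down n)) (ℤ.neg-involutive (+ n))

      module ↑ = Upwards h h-step K connected
      module ↓ = Upwards h⁻ h⁻-step K connected⁻

      ray-escapes : ∀ (t : Ray Γ) (xs : List V) → ¬ (∀ i → Ray.at t i ∈ xs)
      ray-escapes t xs t⊆xs = 1+n≰n
        (injective⇒≤length (Ray.at t ∘ toℕ) (Fin.toℕ-injective ∘ Ray.distinct t) {xs} (t⊆xs ∘ toℕ))

      -- Such a ray would have all its vertices in the finitely many layers of heights strictly
      -- between `-M` and `N`, contradicting their distinctness.
      bounded : ∀ t M N → (∀ i → h⁻ (Ray.at t i) ℤ.< + M) → (∀ i → h (Ray.at t i) ℤ.< + N) → ⊥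
      bounded t M N <M <N = ray-escapes t (concatMap layers (upTo (M + N))) λ i → covered (<M i) (<N i)
        where
        -- Heights `n` and `-n` are collected together, so that the natural numbers below `M + N`
        -- account for both signs.
        layers : ℕ → List V
        layers n = layer (+ n) ++ layer (ℤ.- + n)
        covered : ∀ {x} → h⁻ x ℤ.< + M → h x ℤ.< + N → x ∈ concatMap layers (upTo (M + N))
        covered {x} <M <N with h x | layer-complete {x}
        ... | + n      | x∈ = ∈-concatMap⁺ layers
          (lose (∈-upTo⁺ (≤-trans (ℤ.drop‿+<+ <N) (m≤n+m N M))) (∈-++⁺ˡ x∈))
        ... | -[1+ n ] | x∈ = ∈-concatMap⁺ layers
          (lose (∈-upTo⁺ (≤-trans (ℤ.drop‿+<+ <M) (m≤m+n M N))) (∈-++⁺ʳ (layer (+ suc n)) x∈))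

    -- Every path from `down` to `up` passes through height zero. Infinitely many disjoint paths
    -- would therefore put more vertices into the finite `layer 0ℤ` than it can hold.
    down≁up : ¬ (down ∼ up)
    down≁up down∼up = 1+n≰n (injective⇒≤length (vertexAt ∘ toℕ) vertexAt-injective {layer 0ℤ} vertexAt∈)
      where
      open _∼_ down∼up
      crosses : ∀ n → ∃[ i ] h (vertex (Path.walk (path n)) i) ≡ 0ℤ
      crosses n with i , start ← starts n with j , end ← ends n = ↑.walk-crosses (Path.walk (path n))
        (subst (ℤ._≤ 0ℤ) (sym (trans (cong h start) (h-down i))) ℤ.neg-≤-pos)
        (subst (0ℤ ℤ.≤_) (sym (trans (cong h end) (h-up j))) (ℤ.+≤+ z≤n))
      vertexAt : ℕ → V
      vertexAt n = vertex (Path.walk (path n)) (proj₁ (crosses n))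
      vertexAt-injective : ∀ {m n} → vertexAt (toℕ m) ≡ vertexAt (toℕ n) → m ≡ n
      vertexAt-injective {m} {n} eq with toℕ m ≟ toℕ n
      ... | yes m≡n = Fin.toℕ-injective m≡n
      ... | no  m≢n = ⊥-elim (disjoint _ _ m≢n _ _ eq)
      vertexAt∈ : ∀ i → vertexAt (toℕ i) ∈ layer 0ℤ
      vertexAt∈ i = subst (λ z → vertexAt (toℕ i) ∈ layer z) (proj₂ (crosses (toℕ i))) layer-complete

    -- A ray unbounded below is equivalent to `down` and one unbounded above to `up`; `bounded`
    -- excludes rays that are neither.
    two-ends : ExactlyTwoEnds Γ
    two-ends = down , up , down≁up , classify
      where
      classify : ∀ t → t ∼ down ⊎ t ∼ up
      classify t with em {P = ↓.Unbounded t} | em {P = ↑.Unbounded t}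
      ... | yes unbounded | _             = inj₁ (↓.unbounded⇒∼ down h⁻-down t unbounded)
      ... | no  _         | yes unbounded = inj₂ (↑.unbounded⇒∼ up h-up t unbounded)
      ... | no  ¬↓        | no  ¬↑        = ⊥-elim (¬↓ λ M → decidable-stable em λ M≰ → ¬↑ λ N →
        decidable-stable em λ N≰ → bounded t M N (λ i → ℤ.≰⇒> (λ M≤ → M≰ (i , M≤)))
                                                 (λ i → ℤ.≰⇒> (λ N≤ → N≰ (i , N≤))))

-- Here `k ⊖ i` is the integer difference of two naturals; adding `i` and `j` to both sides clears
-- the subtractions.
⊖-≡⇒+-≡ : ∀ k i l j → k ⊖ i ≡ l ⊖ j → k + j ≡ l + i
⊖-≡⇒+-≡ k i l j eq = ℤ.+-injective (begin
  + (k + j)                       ≡⟨ cong +_ (+-comm k j) ⟩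
  + (j + k)                       ≡⟨⟩
  j + k ⊖ 0                       ≡⟨ ℤ.+-cancelˡ-⊖ i (j + k) 0 ⟨
  i + (j + k) ⊖ (i + 0)           ≡⟨ cong₂ _⊖_ (x∙yz≈y∙xz i j k) (+-identityʳ i) ⟩
  j + (i + k) ⊖ i                 ≡⟨ ℤ.distribʳ-⊖-+-pos j (i + k) i ⟨
  + j ℤ.+ (i + k ⊖ i)             ≡⟨ cong (λ z → + j ℤ.+ z) (ℤ.distribʳ-⊖-+-pos i k i) ⟨
  + j ℤ.+ (+ i ℤ.+ (k ⊖ i))       ≡⟨ cong (λ z → + j ℤ.+ (+ i ℤ.+ z)) eq ⟩
  + j ℤ.+ (+ i ℤ.+ (l ⊖ j))       ≡⟨ cong (λ z → + j ℤ.+ z) (ℤ.distribʳ-⊖-+-pos i l j) ⟩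
  + j ℤ.+ (i + l ⊖ j)             ≡⟨ ℤ.distribʳ-⊖-+-pos j (i + l) j ⟩
  j + (i + l) ⊖ j                 ≡⟨ cong (j + (i + l) ⊖_) (+-identityʳ j) ⟨
  j + (i + l) ⊖ (j + 0)           ≡⟨ ℤ.+-cancelˡ-⊖ j (i + l) 0 ⟩
  + (i + l)                       ≡⟨ cong +_ (+-comm i l) ⟩
  + (l + i)                       ∎)
  where open ≡-Reasoning

-- Highly arc transitive digraphs

module HighlyArcTransitiveDigraph
  (em : ∀ {ℓ} → ExcludedMiddle ℓ)
  {a ℓ : Level} (Γ : Digraph a ℓ)
  (transitive : HighlyArcTransitive Γ)
  (p : ℕ) (p-prime : Prime p)
  (in-valency : ∀ v → InValency Γ v p)
  (out-valency : ∀ v → OutValency Γ v p)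
  where

  open Classical em

  private
    V = Vertex Γ
    variable
      u v w v′ w′ : V

    instance _ = prime⇒nonZero p-prime

  homogeneous : Steps (Arc Γ) k v w → Steps (Arc Γ) k v′ w′ →
                Σ[ g ∈ Automorphism Γ ] apply g v ≡ v′ × apply g w ≡ w′
  homogeneous {k} s t with g , g-maps ← transitive k (toKArc s) (toKArc t) =
    g , g-maps zero ,
    trans (cong (apply g) (sym (vertexOf-last s))) (trans (g-maps (fromℕ k)) (vertexOf-last t))

  outs ins : V → List V
  outs v = proj₁ (hasSize⇒list (out-valency v))
  ins  v = proj₁ (hasSize⇒list (in-valency v))

  outs-enumerates : outs v enumerates Arc Γ v
  outs-enumerates {v} = proj₂ (proj₂ (hasSize⇒list (out-valency v)))

  ins-enumerates : ins v enumerates (λ u → Arc Γ u v)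
  ins-enumerates {v} = proj₂ (proj₂ (hasSize⇒list (in-valency v)))

  length-outs : ∀ v → length (outs v) ≡ p
  length-outs v = proj₁ (proj₂ (hasSize⇒list (out-valency v)))

  length-ins : ∀ v → length (ins v) ≡ p
  length-ins v = proj₁ (proj₂ (hasSize⇒list (in-valency v)))

  1<p : 1 < p
  1<p = nonTrivial⇒n>1 p where instance _ = prime⇒nonTrivial p-prime

  successor : ∀ v → ∃[ w ] Arc Γ v w
  successor v with outs v in eq | length-outs v
  ... | []    | 0≡p = ⊥-elim (<⇒≢ (≤-trans (s≤s z≤n) 1<p) 0≡p)
  ... | w ∷ _ | _   = w , sound outs-enumerates (subst (w ∈_) (sym eq) (here refl))

  predecessor : ∀ v → ∃[ u ] Arc Γ u v
  predecessor v with ins v in eq | length-ins v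
  ... | []    | 0≡p = ⊥-elim (<⇒≢ (≤-trans (s≤s z≤n) 1<p) 0≡p)
  ... | u ∷ _ | _   = u , sound ins-enumerates (subst (u ∈_) (sym eq) (here refl))

  extend : ∀ k v → ∃[ w ] Steps (Arc Γ) k v w
  extend zero    v = v , []
  extend (suc k) v = let u , e = successor v ; w , s = extend k u in w , e ∷ s

  -- By homogeneity all arc sequences of length suc k would be closed, so all
  -- out-neighbours of the penultimate vertex would coincide.
  acyclic : ¬ Steps (Arc Γ) (suc k) v v
  acyclic {k} {v} s with u , s′ , _ ← unsnoc s = <⇒≱ 1<p (begin
    p               ≡⟨ length-outs u ⟨
    length (outs u) ≤⟨ ⊆⇒length≤ {ys = v ∷ []} (unique outs-enumerates)
                        (λ w∈ → here (closed (snoc s′ (sound outs-enumerates w∈)))) ⟩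
    1               ∎)
    where
    open ≤-Reasoning
    closed : Steps (Arc Γ) (suc k) v w → w ≡ v
    closed t with g , gv≡v , gv≡w ← homogeneous s t = trans (sym gv≡w) gv≡v

  -- Descendant levels and their disjointness

  _≟ⱽ_ : (v w : V) → Dec (v ≡ w)
  _ ≟ⱽ _ = em

  -- This lists D_k(v). Different out-neighbours can share descendants, hence the removal of
  -- duplicates.
  level : ℕ → V → List V
  level zero    v = v ∷ []
  level (suc k) v = deduplicate _≟ⱽ_ (concatMap (level k) (outs v))

  level-enumerates : ∀ k {v} → level k v enumerates Steps (Arc Γ) k v
  level-enumerates zero {v} = record
    { unique   = [] ∷ []
    ; sound    = λ { (here refl) → [] }
    ; complete = λ { [] → here refl }
    }
  level-enumerates (suc k) {v} = record
    { unique   = UniqueDec.deduplicate-! _≟ⱽ_ (concatMap (level k) (outs v))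
    ; sound    = λ x∈ →
        let u , u∈ , x∈′ = find (∈-concatMap⁻ (level k) (∈-deduplicate⁻ _≟ⱽ_ _ x∈)) in
        sound outs-enumerates u∈ ∷ sound (level-enumerates k) x∈′
    ; complete = λ { (e ∷ s) → ∈-deduplicate⁺ _≟ⱽ_
        (∈-concatMap⁺ (level k) (lose (complete outs-enumerates e) (complete (level-enumerates k) s))) }
    }

  -- Otherwise D_k(v) ⊆ D_l(v) by homogeneity, so each element of the finite set
  -- D_k(v) is a proper descendant of another one.
  levels-disjoint : Steps (Arc Γ) k v w → ¬ Steps (Arc Γ) (k + suc l) v w
  levels-disjoint {k} {v} {w} {l} s t
    with m , m∈ , m-min ← minimal {_<_ = λ x y → ∃[ n ] Steps (Arc Γ) (suc n) x y}
                            (λ (_ , s) → acyclic s) (λ (_ , s) (_ , t) → _ , s ⊕ t)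
                            (complete (level-enumerates k) s)
    with g , gv≡v , gw≡m ← homogeneous s (sound (level-enumerates k) m∈)
    with x , s₁ , s₂ ← splitAt k (subst₂ (Steps (Arc Γ) (k + suc l)) gv≡v gw≡m (apply-steps g t))
    = m-min (complete (level-enumerates k) s₁) (l , s₂)

  level-unique : Steps (Arc Γ) k v w → Steps (Arc Γ) l v w → k ≡ l
  level-unique {k} {v} {w} {l} s t with <-cmp k l
  ... | tri≈ _ k≡l _ = k≡l
  ... | tri< k<l _ _ = ⊥-elim (levels-disjoint s (subst (λ n → Steps (Arc Γ) n v w)
                         (sym (trans (+-suc k _) (m+[n∸m]≡n k<l))) t))
  ... | tri> _ _ l<k = ⊥-elim (levels-disjoint t (subst (λ n → Steps (Arc Γ) n v w)
                         (sym (trans (+-suc l _) (m+[n∸m]≡n l<k))) s))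

  -- Counting arcs between consecutive levels

  arc? : Decidable (Arc Γ)
  arc? _ _ = em

  parents : ℕ → V → V → List V
  parents k v w = filter (λ u → arc? u w) (level k v)

  parents-enumerates : ∀ k {v w} → parents k v w enumerates (λ u → Steps (Arc Γ) k v u × Arc Γ u w)
  parents-enumerates k = filter-enumerates (λ u → arc? u _) (level-enumerates k)

  -- Transitivity on 0-arcs provides an automorphism taking `v` to `w`, which embeds the one level
  -- into the other.
  level-size-≤ : ∀ k v w → length (level k v) ≤ length (level k w)
  level-size-≤ k v w with g , refl , _ ← homogeneous ([] {x = v}) ([] {x = w}) =
    length≤ (level-enumerates k) (level-enumerates k) (apply g) (apply-injective g) (apply-steps g)

  parents-size-≤ : Steps (Arc Γ) (suc k) v w → Steps (Arc Γ) (suc k) v′ w′ →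
                   length (parents k v w) ≤ length (parents k v′ w′)
  parents-size-≤ {k} s t with g , refl , refl ← homogeneous s t =
    length≤ (parents-enumerates k) (parents-enumerates k) (apply g) (apply-injective g)
            λ (s , e) → apply-steps g s , apply-arc g e

  parents-size-≡ : Steps (Arc Γ) (suc k) v w → Steps (Arc Γ) (suc k) v′ w′ →
                   length (parents k v w) ≡ length (parents k v′ w′)
  parents-size-≡ s t = ≤-antisym (parents-size-≤ s t) (parents-size-≤ t s)

  -- Both sides count the arcs from D_k(v) to D_{k+1}(v). All `p` out-neighbours of a vertex of the
  -- first level lie in the second, and by homogeneity all vertices of the second level have equally
  -- many parents.
  count-arcs : Steps (Arc Γ) (suc k) v w →
               length (level k v) * p ≡ length (level (suc k) v) * length (parents k v w)
  count-arcs {k} {v} {w} s = begin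
    length (level k v) * p
      ≡⟨ sum-const _ p (level k v) children ⟨
    sum (map (λ x → length (filter (arc? x) (level (suc k) v))) (level k v))
      ≡⟨ double-count arc? (level k v) (level (suc k) v) ⟩
    sum (map (parents-size) (level (suc k) v))
      ≡⟨ sum-const _ (parents-size w) (level (suc k) v)
           (λ y∈ → parents-size-≡ (sound (level-enumerates (suc k)) y∈) s) ⟩
    length (level (suc k) v) * parents-size w ∎
    where
    open ≡-Reasoning
    parents-size : V → ℕ
    parents-size y = length (parents k v y)
    children : ∀ {x} → x ∈ level k v → length (filter (arc? x) (level (suc k) v)) ≡ p
    children {x} x∈ = trans
      (length-≡ (filter-enumerates (arc? x) (level-enumerates (suc k))) outs-enumerates
        proj₂ (λ e → snoc (sound (level-enumerates k) x∈) e , e))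
      (length-outs x)

  level-size-∣ : ∀ k v → length (level k v) ∣ p ^ k
  level-size-∣ zero    v = ∣-refl
  level-size-∣ (suc k) v with w , s ← extend (suc k) v = begin
    length (level (suc k) v)                          ∣⟨ m∣m*n (length (parents k v w)) ⟩
    length (level (suc k) v) * length (parents k v w) ≡⟨ count-arcs s ⟨
    length (level k v) * p                            ∣⟨ *-monoˡ-∣ p (level-size-∣ k v) ⟩
    p ^ k * p                                         ≡⟨ *-comm (p ^ k) p ⟩
    p ^ suc k                                         ∎
    where open ∣-Reasoning

  -- The number of parents divides `p ^ suc k` by `count-arcs`. It is nonzero because the given walk
  -- has a penultimate vertex, and at most `p` by the in-valency.
  parents-size-1⊎p : Steps (Arc Γ) (suc k) v w → length (parents k v w) ≡ 1 ⊎ length (parents k v w) ≡ p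
  parents-size-1⊎p {k} {v} {w} s with u , s′ , e ← unsnoc s =
    prime-power-divisor p-prime (suc k) parents≤p (begin
      length (parents k v w)                            ∣⟨ n∣m*n (length (level (suc k) v)) ⟩
      length (level (suc k) v) * length (parents k v w) ≡⟨ count-arcs s ⟨
      length (level k v) * p                            ∣⟨ *-monoˡ-∣ p (level-size-∣ k v) ⟩
      p ^ k * p                                         ≡⟨ *-comm (p ^ k) p ⟩
      p ^ suc k                                         ∎)
    where
    open ∣-Reasoning
    instance _ = >-nonZero (∈-length (complete (parents-enumerates k) (s′ , e)))
    parents≤p : length (parents k v w) ≤ p
    parents≤p = subst (length (parents k v w) ≤_) (length-ins w)
      (length≤ (parents-enumerates k) ins-enumerates id id proj₂)

  UniqueParents : Set _
  UniqueParents = ∀ {k v w u u′} → Steps (Arc Γ) k v u → Arc Γ u w →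
                  Steps (Arc Γ) k v u′ → Arc Γ u′ w → u ≡ u′

  Full : ℕ → Set _
  Full k = ∀ {v w u} → Steps (Arc Γ) (suc k) v w → Arc Γ u w → Steps (Arc Γ) k v u

  -- The first arc is set aside, `full` is applied to the rest of the walk, and the arc is put back.
  full-suc : Full k → Full (suc k)
  full-suc full (e ∷ s) d = e ∷ full s d

  full-+ : ∀ l → Full k → Full (l + k)
  full-+ zero    full = full
  full-+ (suc l) full = full-suc (full-+ l full)

  -- A set of `p` parents exhausts the `p` in-neighbours. A single pair `v`, `w` suffices, since the
  -- number of parents depends only on `k`.
  parents-size-p⇒full : Steps (Arc Γ) (suc k) v w → length (parents k v w) ≡ p → Full k
  parents-size-p⇒full {k} s size≡p {w = w′} t e = proj₁ (sound (parents-enumerates k)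
    (⊆∧length≥⇒⊇ (unique (parents-enumerates k))
      (complete ins-enumerates ∘ proj₂ ∘ sound (parents-enumerates k))
      (≤-reflexive (trans (length-ins w′) (trans (sym size≡p) (parents-size-≡ s t))))
      (complete ins-enumerates e)))

  -- When every vertex of the lower level has `p` parents, the factor `p` cancels in `count-arcs`.
  full⇒level-size : Full k → ∀ v → length (level k v) ≡ length (level (suc k) v)
  full⇒level-size {k} full v with w , s ← extend (suc k) v =
    *-cancelʳ-≡ (length (level k v)) _ p (trans (count-arcs s) (cong (length (level (suc k) v) *_)
      (trans (length-≡ (parents-enumerates k) ins-enumerates proj₂ λ e → full s e , e) (length-ins w))))

  dichotomy : UniqueParents ⊎ ∃[ k ] Full k
  dichotomy with em {P = ∃[ k ] ∃[ v ] ∃[ w ] Steps (Arc Γ) (suc k) v w × length (parents k v w) ≡ p}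
  ... | yes (k , v , w , s , size≡p) = inj₂ (k , parents-size-p⇒full s size≡p)
  ... | no  ¬full = inj₁ λ {k} {v} {w} {u} {u′} s e s′ e′ → unique-parent k v w u u′ s e s′ e′
    where
    unique-parent : ∀ k v w u u′ → Steps (Arc Γ) k v u → Arc Γ u w →
                    Steps (Arc Γ) k v u′ → Arc Γ u′ w → u ≡ u′
    unique-parent k v w u u′ s e s′ e′ with parents-size-1⊎p (snoc s e)
    ... | inj₂ size≡p = ⊥-elim (¬full (k , v , w , snoc s e , size≡p))
    ... | inj₁ size≡1 with parents k v w | size≡1 | complete (parents-enumerates k) (s , e)
                                                  | complete (parents-enumerates k) (s′ , e′)
    ...   | _ ∷ [] | _ | here refl | here refl = refl

  -- Unique parents: the descendant set spans a tree

  module DescendantTree (unique-parent : UniqueParents) (v : V) where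

    Δ = descendants Γ v

    W = Vertex Δ

    Edge = SymClosure (Arc Δ)

    embed : ∀ {u} → Steps (Arc Γ) k v u → W
    embed {u = u} s = u , [ _ , toKArcFromTo s ]

    root : W
    root = embed []

    descends : ∀ x → ∃[ k ] Steps (Arc Γ) k v (value x)
    -- The proof `d` is irrelevant; excluded middle makes the proposition decidable, so a usable
    -- witness can be recomputed.
    descends (x , [ d ]) = let k , s = recompute (em {P = Descendant Γ v x}) d in k , fromKArcFromTo s

    h : W → ℕ
    h = proj₁ ∘ descends

    at : ∀ x → Steps (Arc Γ) (h x) v (value x)
    at = proj₂ ∘ descends

    -- Levels are disjoint, so the depth does not depend on which walk `recompute` yields.
    h-unique : ∀ {x} → Steps (Arc Γ) k v (value x) → h x ≡ k
    h-unique {x = x} = level-unique (at x)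

    h-arc : ∀ x y → Arc Δ x y → h y ≡ suc (h x)
    h-arc x y e = h-unique {x = y} (snoc (at x) e)

    lift-steps : ∀ x {u} → Steps (Arc Γ) n (value x) u → ∃[ y ] value y ≡ u × Steps (Arc Δ) n x y
    lift-steps x []      = x , refl , []
    lift-steps x (e ∷ s) = let z , z≡u , t = lift-steps (embed (snoc (at x) e)) s in z , z≡u , e ∷ t

    from-root : ∀ x → Steps (Arc Δ) (h x) root x
    from-root x with y , y≡x , s ← lift-steps root (at x) with refl ← value-injective {v = y} {w = x} y≡x = s

    connected : Connected Δ
    connected x y = Eq.transitive _ (Eq.symmetric _ (steps⇒closure (from-root x))) (steps⇒closure (from-root y))

    -- Both parents have depth one less than `z`, hence lie in the same level, as `UniqueParents`
    -- demands.
    parent-unique : ∀ x y z → Arc Δ x z → Arc Δ y z → x ≡ y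
    parent-unique x y z d e = value-injective (unique-parent (at x) d
      (subst (λ k → Steps (Arc Γ) k v (value y)) (suc-injective (trans (sym (h-arc y z e)) (h-arc x z d))) (at y)) e)

    lower⇒parent : ∀ x y → Edge x y → h x ≤ h y → Arc Δ x y
    lower⇒parent x y (fwd e) _     = e
    lower⇒parent x y (bwd e) hx≤hy = ⊥-elim (<⇒≱ (≤-reflexive (sym (h-arc y x e))) hx≤hy)

    -- Both neighbours of a vertex of maximal height on a cycle would be its parents.
    ¬cycle : ¬ Cycle Δ
    ¬cycle record { n = 0 ; closing = fwd e } = acyclic (e ∷ [])
    ¬cycle record { n = 0 ; closing = bwd e } = acyclic (e ∷ [])
    ¬cycle record { n = 1 ; n≢1 = n≢1 } = n≢1 refl
    ¬cycle record { n = n@(2+ _) ; walk = w ; distinct = distinct ; closing = closing }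
      with m , _ , m-max ← minimal {_<_ = λ i j → h (vertex w j) < h (vertex w i)}
                             (<-irrefl refl) (λ p q → <-trans q p) (∈-allFin {n = suc n} zero)
      with i , j , i≢j , d , e ← two-neighbours w closing m
      = i≢j (distinct (parent-unique (vertex w i) (vertex w j) (vertex w m)
          (lower⇒parent (vertex w i) (vertex w m) d (≮⇒≥ (m-max (∈-allFin i))))
          (lower⇒parent (vertex w j) (vertex w m) e (≮⇒≥ (m-max (∈-allFin j))))))

    h-steps : ∀ {x y} → Steps Edge n x y → h y ≤ n + h x
    h-steps []                                  = ≤-refl
    h-steps {x = x} (_∷_ {n} {y = y} (fwd e) s) = ≤-trans (h-steps s)
      (≤-reflexive (trans (cong (λ m → n + m) (h-arc x y e)) (+-suc n (h x))))
    h-steps {x = x} (_∷_ {n} {y = y} (bwd e) s) = ≤-trans (h-steps s)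
      (≤-trans (+-monoʳ-≤ n (≤-trans (n≤1+n (h y)) (≤-reflexive (sym (h-arc y x e))))) (n≤1+n _))

    h≤distance : ∀ {x} → KArcFromTo (underlying Δ) n root x → h x ≤ n
    h≤distance {n = n} s = ≤-trans (h-steps (fromKArcFromTo {Γ = underlying Δ} s))
      (≤-reflexive (trans (cong (λ m → n + m) (h-unique {x = root} [])) (+-identityʳ n)))

    map-fwd : ∀ {x y} → Steps (Arc Δ) n x y → Steps Edge n x y
    map-fwd []      = []
    map-fwd (e ∷ s) = fwd e ∷ map-fwd s

    geodesic : ∀ x → KArcFromTo (underlying Δ) (h x) root x
    geodesic x = toKArcFromTo {Γ = underlying Δ} (map-fwd (from-root x))

    -- The depth `h` is the distance from the root: `from-root` gives a walk of that length, and no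
    -- edge raises the depth by more than one.
    directed : DirectedAwayFrom Δ root
    directed x y n e (s , n-min) = subst (Distance Δ root y) hy≡1+n (geodesic y , λ _ → h≤distance)
      where
      hy≡1+n : h y ≡ suc n
      hy≡1+n = trans (h-arc x y e) (cong suc (≤-antisym (h≤distance s) (n-min (h x) (geodesic x))))

    out-valency′ : ∀ x → OutValency Δ x p
    out-valency′ x with f , f-injective , arc⇔ ← out-valency (value x) =
      child , f-injective ∘ cong value , λ y → mk⇔
        (λ e → let i , fi≡y = Equivalence.to (arc⇔ (value y)) e in i , value-injective fi≡y)
        (λ { (i , refl) → child-arc i })
      where
      child-arc : ∀ i → Arc Γ (value x) (f i)
      child-arc i = Equivalence.from (arc⇔ (f i)) (i , refl)
      child : Fin p → W
      child i = embed (snoc (at x) (child-arc i))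

    rooted-tree : RootedTree p Δ
    rooted-tree = (connected , ¬cycle) , (root , directed) , out-valency′

  -- A full level: height function and finite layers

  module FullLevel (Γ-connected : Connected Γ) (K : ℕ) (full : Full K) (v₀ : Vertex Γ) where

    open Ends em Γ using (Near; module Strip)

    level-size-stable : ∀ l v → length (level (l + K) v) ≡ length (level K v)
    level-size-stable zero    v = refl
    level-size-stable (suc l) v = trans (sym (full⇒level-size (full-+ l full) v)) (level-size-stable l v)

    -- Since `v` lies in D_j(u), the set D_{l+K}(v) is contained in D_{j+l+K}(u). Level sizes are
    -- constant from `K` on, so the two sets coincide.
    descend : ∀ l {x} → Steps (Arc Γ) j u v → Steps (Arc Γ) (j + (l + K)) u x → Steps (Arc Γ) (l + K) v x
    descend {j} {u} {v} l s t = sound (level-enumerates (l + K))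
      (⊆∧length≥⇒⊇ (unique (level-enumerates (l + K)))
        (λ x∈ → complete (level-enumerates (j + (l + K))) (s ⊕ sound (level-enumerates (l + K)) x∈))
        size≤ (complete (level-enumerates (j + (l + K))) t))
      where
      open ≤-Reasoning
      size≤ : length (level (j + (l + K)) u) ≤ length (level (l + K) v)
      size≤ = begin
        length (level (j + (l + K)) u) ≡⟨ cong (λ k → length (level k u)) (+-assoc j l K) ⟨
        length (level (j + l + K) u)   ≡⟨ level-size-stable (j + l) u ⟩
        length (level K u)             ≤⟨ level-size-≤ K u v ⟩
        length (level K v)             ≡⟨ level-size-stable l v ⟨
        length (level (l + K) v)       ∎

    ancestor : ℕ → V
    ancestor zero    = v₀
    ancestor (suc i) = proj₁ (predecessor (ancestor i))

    from-ancestor : ∀ i j → Steps (Arc Γ) j (ancestor (j + i)) (ancestor i)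
    from-ancestor i zero    = []
    from-ancestor i (suc j) = proj₂ (predecessor (ancestor (j + i))) ∷ from-ancestor i j

    At : ℕ → ℕ → V → Set _
    At i k x = Steps (Arc Γ) k (ancestor i) x

    raise : ∀ i j {x} → At i k x → At (j + i) (j + k) x
    raise i j s = from-ancestor i j ⊕ s

    At-subst : ∀ {i i′ k k′ x} → i ≡ i′ → k ≡ k′ → At i k x → At i′ k′ x
    At-subst refl refl s = s

    -- Seen from the common ancestor `ancestor (i + j)`, the equal differences become equal walk
    -- lengths; `descend` then shortens the walk to one from `ancestor j`.
    relocate : ∀ {k x} i j l → k ⊖ i ≡ l + K ⊖ j → At i k x → At j (l + K) x
    relocate {k} i j l eq s = descend l (from-ancestor j i)
      (At-subst (+-comm j i) (trans (+-comm j k) (trans (⊖-≡⇒+-≡ k i (l + K) j eq) (+-comm (l + K) i))) (raise i j s))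

    -- By connectedness it suffices to follow single arcs from `v₀`. A forward arc increases `l`;
    -- for a backward arc the walk is first extended by one ancestor, and fullness then supplies the
    -- walk to the in-neighbour.
    covered : ∀ x → ∃[ i ] ∃[ l ] At i (l + K) x
    covered x = closed (Γ-connected v₀ x) (K , 0 , At-subst (+-identityʳ K) (+-identityʳ K) (raise 0 K []))
      where
      Covered : V → Set _
      Covered x = ∃[ i ] ∃[ l ] At i (l + K) x
      closed : ∀ {x y} → EqClosure (Arc Γ) x y → Covered x → Covered y
      closed ε            c           = c
      closed (fwd e ◅ es) (i , l , s) = closed es (i , suc l , snoc s e)
      closed (bwd e ◅ es) (i , l , s) = closed es (suc i , l , full-+ l full (raise i 1 s) e)

    h : V → ℤ
    h x = let i , l , _ = covered x in l + K ⊖ i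

    -- The height is independent of the choice made by `covered`: two walks to `x` can be extended
    -- to start at the same ancestor, and `level-unique` equates their lengths.
    h-at : ∀ i {x} → At i k x → h x ≡ k ⊖ i
    h-at {k} i {x} s = let j , l , t = covered x in begin
      l + K ⊖ j             ≡⟨ ℤ.+-cancelˡ-⊖ i (l + K) j ⟨
      i + (l + K) ⊖ (i + j) ≡⟨ cong₂ _⊖_ (level-unique (raise j i t) (At-subst (+-comm j i) refl (raise i j s))) (+-comm i j) ⟩
      j + k ⊖ (j + i)       ≡⟨ ℤ.+-cancelˡ-⊖ j k i ⟩
      k ⊖ i                 ∎
      where open ≡-Reasoning

    h-rise : ∀ {x y} → Steps (Arc Γ) n x y → h y ≡ + n ℤ.+ h x
    h-rise {n} {x} s = let i , l , t = covered x in begin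
      h _                     ≡⟨ h-at i (t ⊕ s) ⟩
      l + K + n ⊖ i           ≡⟨ cong (_⊖ i) (+-comm (l + K) n) ⟩
      n + (l + K) ⊖ i         ≡⟨ ℤ.distribʳ-⊖-+-pos n (l + K) i ⟨
      + n ℤ.+ (l + K ⊖ i)     ∎
      where open ≡-Reasoning

    -- Height `n` is written as `(n + K) - K` and height `-(n + 1)` as `K - (suc n + K)`, so that
    -- the level index is at least `K`, as `relocate` requires.
    layer : ℤ → List V
    layer (+ n)    = level (n + K) (ancestor K)
    layer -[1+ n ] = level K (ancestor (suc n + K))

    layer-complete : ∀ {x} → x ∈ layer (h x)
    layer-complete {x} = let i , l , s = covered x in in-layer i (h x) (h-at i s) s
      where
      in-layer : ∀ {k} i z → z ≡ k ⊖ i → At i k x → x ∈ layer z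
      in-layer i (+ n)    eq s = complete (level-enumerates (n + K)) (relocate i K n (trans (sym eq)
        (sym (trans (cong₂ _⊖_ (+-comm n K) (sym (+-identityʳ K))) (ℤ.+-cancelˡ-⊖ K n 0)))) s)
      in-layer i -[1+ n ] eq s = complete (level-enumerates K) (relocate i (suc n + K) 0 (trans (sym eq)
        (sym (trans (cong₂ _⊖_ (sym (+-identityʳ K)) (+-comm (suc n) K)) (ℤ.+-cancelˡ-⊖ K 0 (suc n))))) s)

    near : ∀ {x y} → n ≤ K → Steps (Arc Γ) n x y → Near h K (h y) x
    near {n} {x} {y} n≤K s =
      ℤ.≤-trans (ℤ.≤-trans (ℤ.i≤j+i (h x) (+ n)) (ℤ.≤-reflexive (sym (h-rise s)))) (ℤ.i≤i+j (h y) (+ K)) ,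
      ℤ.≤-trans (ℤ.≤-reflexive (trans (h-rise s) (ℤ.+-comm (+ n) (h x)))) (ℤ.+-monoʳ-≤ (h x) (ℤ.+≤+ n≤K))

    near-closure : ∀ {x y} → n ≤ K → Steps (Arc Γ) n x y → EqClosure (Restrict (Arc Γ) (Near h K (h y))) x y
    near-closure n≤K []      = ε
    near-closure n≤K (e ∷ s) = fwd (e , near n≤K (e ∷ s) , near n≤K′ s) ◅ near-closure n≤K′ s
      where n≤K′ = ≤-trans (n≤1+n _) n≤K

    -- x and y have a common ancestor K levels above them.
    layer-connected : ∀ {x y} → h x ≡ h y → EqClosure (Restrict (Arc Γ) (Near h K (h x))) x y
    layer-connected {x} {y} hx≡hy =
      let ix , lx , sx  = covered x
          iy , _  , sy  = covered y
          v  , s₁ , s₂  = splitAt lx sx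
      in  Eq.transitive _ (Eq.symmetric _ (near-closure ≤-refl s₂))
            (subst (λ z → EqClosure (Restrict (Arc Γ) (Near h K z)) v y) (sym hx≡hy)
              (near-closure ≤-refl (descend 0 s₁ (relocate iy ix lx (sym hx≡hy) sy))))

    descendant : ℕ → V
    descendant zero    = v₀
    descendant (suc n) = proj₁ (successor (descendant n))

    to-descendant : ∀ n → At 0 n (descendant n)
    to-descendant zero    = []
    to-descendant (suc n) = snoc (to-descendant n) (proj₂ (successor (descendant n)))

    h-ancestor : ∀ n → h (ancestor n) ≡ ℤ.- + n
    h-ancestor n = trans (h-at n []) (ℤ.⊖-≤ z≤n)

    h-descendant : ∀ n → h (descendant n) ≡ + n
    h-descendant n = h-at 0 (to-descendant n)

    down up : Ray Γ
    down = record
      { at       = ancestor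
      ; distinct = λ {m} {n} eq → ℤ.+-injective (ℤ.neg-injective
                     (trans (sym (h-ancestor m)) (trans (cong h eq) (h-ancestor n))))
      ; step     = λ n → bwd (proj₂ (predecessor (ancestor n)))
      }
    up = record
      { at       = descendant
      ; distinct = λ {m} {n} eq → ℤ.+-injective
                     (trans (sym (h-descendant m)) (trans (cong h eq) (h-descendant n)))
      ; step     = λ n → fwd (proj₂ (successor (descendant n)))
      }

    two-ended : TwoEnded Γ
    two-ended = Γ-connected , Strip.two-ends h (λ e → h-rise (e ∷ [])) layer layer-complete
                                K layer-connected down up h-ancestor h-descendant

theorem19 : (∀ {ℓ} → ExcludedMiddle ℓ) →
    ∀ {a ℓ} (Γ : Digraph a ℓ) →
    Infinite Γ →
    HighlyArcTransitive Γ →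
    Connected Γ →
    (p : ℕ) → Prime p →
    (∀ v → InValency Γ v p) →
    (∀ v → OutValency Γ v p) →
    TwoEnded Γ ⊎ (∀ v → RootedTree p (descendants Γ v))
theorem19 em Γ _ transitive connected p p-prime in-valency out-valency = by-cases dichotomy em
  where
  open HighlyArcTransitiveDigraph em Γ transitive p p-prime in-valency out-valency
  by-cases : UniqueParents ⊎ ∃[ k ] Full k → Dec (Vertex Γ) →
             TwoEnded Γ ⊎ (∀ v → RootedTree p (descendants Γ v))
  by-cases (inj₁ unique-parent) _          = inj₂ (DescendantTree.rooted-tree unique-parent)
  by-cases (inj₂ (K , full))    (yes v₀)   = inj₁ (FullLevel.two-ended connected K full v₀)
  -- The strip is built around a base vertex; when there is none, the claim about every `v` holds
  -- vacuously.
  by-cases (inj₂ _)             (no empty) = inj₂ (⊥-elim ∘ empty)
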